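{- For every $\mathcal L_{\mathrm{wit}}$-term $t(x)$ that is either closed or has $x$ as its only free variable, there exist a polynomial $Q_t(T)\in\mathbb D[T]$ and a natural number $q_t$ such that, for every $q\ge q_t$, $$t^{\mathfrak N_{\mathrm{wit}}^*}(c_q)=Q_t(U_q).$$
   Context: $\mathbb N$ contains $0$. $\mathbb D=\mathbb Z[1/2]$ is the ring of dyadic rationals. For $q\in\mathbb N$ put $U_q=2^q$, and for $q\ge2$ put $c_q=\frac54U_q=5\cdot2^{q-2}$; expressions involving $c_q$ are considered only for $q\ge 2$. The language is $\mathcal L_{\mathrm{wit}}=\{0,1,+,\cdot,\le\}\cup\{\operatorname{sub},\operatorname{po},\operatorname{quo},\operatorname{half},\operatorname{obst},\operatorname{cof}\}$, where $\operatorname{sub},\operatorname{quo}$ are binary function symbols and $\operatorname{po},\operatorname{half},\operatorname{obst},\operatorname{cof}$ are unary function symbols. $\mathfrak N_{\mathrm{wit}}^*$ is the $\mathcal L_{\mathrm{wit}}$-structure with universe $\mathbb N$, with $0,1,+,\cdot,\le$ interpreted as usual, and: - $\operatorname{sub}(x,y)=x-y$ if $y\le x$, and $0$ otherwise; - $\operatorname{po}(x)=\max\{2^n\mid n\in\mathbb N,\ 2^n\le x+1\}$; - $\operatorname{quo}(s,r)=r/s$ if $s=2^m$ and $r=2^n$ for some $m,n\in\mathbb N$ and $s\le r$, and $0$ otherwise; - $\operatorname{half}(y)=y/2$ if $2\mid y$, and $0$ otherwise; - $\operatorname{obst}(0)=3$ and $\operatorname{cof}(0)=0$; for $n\ge1$,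 $\operatorname{obst}(n)=n/2^{\nu_2(n)}$ and $\operatorname{cof}(n)=2^{\nu_2(n)}$, where $\nu_2$ is the usual $2$-adic valuation. $t^{\mathfrak N_{\mathrm{wit}}^*}(c)$ is the value of $t$ in $\mathfrak N_{\mathrm{wit}}^*$ when $x$ is assigned $c$. -}

module Defs where

open import Data.Fin.Base using (Fin)
open import Data.Integer.Base as ℤ using (ℤ)
open import Data.List.Base using (List; []; _∷_; filter; map; upTo)
open import Data.List.Extrema.Nat using (max; argmax-all; v≤max⁺)
open import Data.List.Membership.Propositional using (lose)
open import Data.List.Membership.Propositional.Properties
  using (∈-filter⁺; ∈-map⁺; ∈-upTo⁺)
open import Data.List.Relation.Unary.All as All using ()
open import Data.List.Relation.Unary.All.Properties using (all-filter; filter⁺; map⁺)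
open import Data.Nat.Base
open import Data.Nat.Divisibility using (_∣_; _∣?_; 1∣_; ∣⇒≤)
open import Data.Nat.DivMod using (_/_)
open import Data.Nat.Properties
open import Data.Nat.Tactic.RingSolver using (solve-∀)
open import Data.Product.Base using (_×_; _,_; Σ-syntax; ∃-syntax)
open import Data.Rational.Base as ℚ using (ℚ; 0ℚ)
open import Data.Sum.Base using (inj₂)
open import Data.Vec.Base using (Vec; lookup)
open import Relation.Binary.PropositionalEquality using (_≡_; refl; cong; sym; subst)
open import Relation.Nullary.Decidable using (Dec; yes; no; map′; _×-dec_)

n<2^n : ∀ n → n < 2 ^ n
n<2^n zero    = s≤s z≤n
n<2^n (suc n) = subst (suc (suc n) ≤_) (cong (2 ^ n +_) (sym (+-identityʳ (2 ^ n))))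
                      (+-mono-≤ (m^n>0 2 n) (n<2^n n))

infixl 7 _/2^_

_/2^_ : ℕ → ℕ → ℕ
n /2^ k = (n / 2 ^ k) {{m^n≢0 2 k}}

infixl 6 _+ᵗ_
infixl 7 _*ᵗ_

-- The relation symbol ≤ of the language does not occur in terms.
data Term (n : ℕ) : Set where
  var                : Fin n → Term n
  0ᵗ 1ᵗ              : Term n
  _+ᵗ_ _*ᵗ_          : Term n → Term n → Term n
  sub quo            : Term n → Term n → Term n
  po half obst cof   : Term n → Term n

IsPow₂ : ℕ → Set
IsPow₂ x = ∃[ n ] x ≡ 2 ^ n

isPow₂? : ∀ x → Dec (IsPow₂ x)
isPow₂? x = map′ (λ { (n , _ , eq) → n , eq })
                 (λ { (n , refl) → n , n<2^n n , refl })
                 (anyUpTo? (λ n → x ≟ 2 ^ n) x)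

-- 2 ^ n ≤ x + 1 forces n ≤ x, so a bounded search suffices; the default
-- value 1 = 2 ^ 0 is itself always a candidate.
poᴺ : ℕ → ℕ
poᴺ x = max 1 (filter (_≤? x + 1) (map (2 ^_) (upTo (x + 1))))

poᴺ-attained : ∀ x → ∃[ n ] (poᴺ x ≡ 2 ^ n × 2 ^ n ≤ x + 1)
poᴺ-attained x with argmax-all (λ y → y) {P = λ y → IsPow₂ y × y ≤ x + 1}
    ((0 , refl) , m≤n+m 1 x)
    (All.zip (filter⁺ (_≤? x + 1) (map⁺ {xs = upTo (x + 1)} (All.universal (λ n → n , refl) _))
             , all-filter (_≤? x + 1) (map (2 ^_) (upTo (x + 1)))))
... | (n , eq) , le = n , eq , subst (_≤ x + 1) eq le

poᴺ-greatest : ∀ x n → 2 ^ n ≤ x + 1 → 2 ^ n ≤ poᴺ x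
poᴺ-greatest x n le = v≤max⁺ 1 _ (inj₂ (lose
  (∈-filter⁺ (_≤? x + 1) (∈-map⁺ (2 ^_) (∈-upTo⁺ (<-≤-trans (n<2^n n) le))) le) ≤-refl))

quoᴺ : ℕ → ℕ → ℕ
quoᴺ s r with isPow₂? s ×-dec isPow₂? r ×-dec (s ≤? r)
... | yes ((m , _) , _ , _) = r /2^ m
... | no  _                 = 0

halfᴺ : ℕ → ℕ
halfᴺ y with 2 ∣? y
... | yes _ = y / 2
... | no  _ = 0

-- The 2-adic valuation of a positive n: 2 ^ k ∣ n forces k < n.  The value
-- ν₂ 0 = 0 is never used.
ν₂ : ℕ → ℕ
ν₂ n = max 0 (filter (λ k → 2 ^ k ∣? n) (upTo n))

ν₂-divides : ∀ n → 2 ^ ν₂ n ∣ n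
ν₂-divides n = argmax-all (λ k → k) {P = λ k → 2 ^ k ∣ n} (1∣ n)
                          (all-filter (λ k → 2 ^ k ∣? n) (upTo n))

ν₂-greatest : ∀ n .{{_ : NonZero n}} k → 2 ^ k ∣ n → k ≤ ν₂ n
ν₂-greatest n k d = v≤max⁺ 0 _ (inj₂ (lose
  (∈-filter⁺ (λ k → 2 ^ k ∣? n) (∈-upTo⁺ (<-≤-trans (n<2^n k) (∣⇒≤ d))) d) ≤-refl))

obstᴺ : ℕ → ℕ
obstᴺ zero        = 3
obstᴺ n@(suc _)   = n /2^ ν₂ n

cofᴺ : ℕ → ℕ
cofᴺ zero         = 0
cofᴺ n@(suc _)    = 2 ^ ν₂ n

⟦_⟧ : ∀ {n} → Term n → Vec ℕ n → ℕ
⟦ var i   ⟧ ρ = lookup ρ i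
⟦ 0ᵗ      ⟧ ρ = 0
⟦ 1ᵗ      ⟧ ρ = 1
⟦ s +ᵗ t  ⟧ ρ = ⟦ s ⟧ ρ + ⟦ t ⟧ ρ
⟦ s *ᵗ t  ⟧ ρ = ⟦ s ⟧ ρ * ⟦ t ⟧ ρ
⟦ sub s t ⟧ ρ = ⟦ s ⟧ ρ ∸ ⟦ t ⟧ ρ
⟦ quo s t ⟧ ρ = quoᴺ (⟦ s ⟧ ρ) (⟦ t ⟧ ρ)
⟦ po t    ⟧ ρ = poᴺ (⟦ t ⟧ ρ)
⟦ half t  ⟧ ρ = halfᴺ (⟦ t ⟧ ρ)
⟦ obst t  ⟧ ρ = obstᴺ (⟦ t ⟧ ρ)
⟦ cof t   ⟧ ρ = cofᴺ (⟦ t ⟧ ρ)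

-- ℤ[1/2] as a subset of ℚ.
record 𝔻 : Set where
  constructor mk𝔻
  field
    value  : ℚ
    dyadic : Σ[ a ∈ ℤ ] Σ[ k ∈ ℕ ] value ≡ (a ℚ./ 2 ^ k) {{m^n≢0 2 k}}

open 𝔻 public

-- Coefficient lists, constant term first; trailing zeros are allowed.
𝔻[T] : Set
𝔻[T] = List 𝔻

eval : 𝔻[T] → ℚ → ℚ
eval []      u = 0ℚ
eval (a ∷ p) u = value a ℚ.+ u ℚ.* eval p u

fromℕ : ℕ → ℚ
fromℕ n = ℤ.+ n ℚ./ 1

U : ℕ → ℕ
U q = 2 ^ q

-- Used only for q ≥ 2, where it is (5/4) * U q.
c : ℕ → ℕ
c q = 5 * 2 ^ (q ∸ 2)

4c≡5U : ∀ q → 2 ≤ q → 4 * c q ≡ 5 * U q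
4c≡5U (suc (suc q)) _ = lemma (2 ^ q)
  where
  lemma : ∀ u → 4 * (5 * u) ≡ 5 * (2 * (2 * u))
  lemma = solve-∀
4c≡5U (suc zero) (s≤s ())

{-# OPTIONS --safe #-}
-- The functions of q that eventually agree with a polynomial in U = 2 ^ q over
-- ℤ[1/2] contain c and are closed under every operation of the language.
-- Each such function has an eventually constant sign, which settles sub.  A
-- positive one is eventually enclosed in 2 ^ e ≤ f < 2 ^ (e + 1) with e affine
-- in q, which settles po and, by the sign of f - 2 ^ e, decides whether f is a
-- power of two (quo).  Pulling 2 out of the lowest nonzero coefficient gives
-- f = 2 ^ e * (1 + 2 * g) with e affine and g of the same kind, which settles
-- half, obst and cof.
module Submission where

open import Defs
open import Data.Empty using (⊥; ⊥-elim)
open import Data.Fin.Base using (zero)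
open import Data.Integer.Base as ℤ using (ℤ; +_; -[1+_]; 0ℤ; 1ℤ; ∣_∣)
import Data.Integer.Properties as ℤP
import Data.Integer.Tactic.RingSolver as ℤSolver
open import Data.List.Base using ([]; _∷_)
open import Data.Nat.Base using (ℕ; zero; suc; _+_; _*_; _∸_; _^_; _≤_; _<_; _⊔_; z≤n; s≤s; NonZero)
open import Data.Nat.Divisibility using (_∣_; _∣?_; ∣-trans; ∣m+n∣m⇒∣n; m∣m*n; *-cancelˡ-∣; ∣1⇒≡1)
open import Data.Nat.DivMod using (_/_; m*n/n≡m)
open import Data.Nat.Induction using (<-rec)
open import Data.Nat.Properties
open import Data.Nat.Tactic.RingSolver using (solve-∀)
open import Data.Product.Base using (_×_; _,_; Σ-syntax; ∃-syntax; proj₁; proj₂)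
open import Data.Rational.Base as ℚ using (ℚ)
import Data.Rational.Properties as ℚP
open import Data.Rational.Solver using (module +-*-Solver)
import Data.Rational.Unnormalised.Base as ℚᵘ
import Data.Rational.Unnormalised.Properties as ℚᵘP
open import Data.Sum.Base using (_⊎_; inj₁; inj₂)
open import Data.Vec.Base using ([]; _∷_)
open import Relation.Binary.Definitions using (tri<; tri≈; tri>)
open import Relation.Binary.PropositionalEquality using (_≡_; refl; sym; trans; cong; cong₂; subst; module ≡-Reasoning)
open import Relation.Nullary.Decidable using (yes; no; _×-dec_)
open import Relation.Nullary.Negation using (¬_; contradiction)

-- Powers of two, and the interpreted functions on arguments of known shape

2^-mono-≤ : ∀ {m n} → m ≤ n → 2 ^ m ≤ 2 ^ n
2^-mono-≤ = ^-monoʳ-≤ 2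

2^-cancel-< : ∀ m n → 2 ^ m < 2 ^ n → m < n
2^-cancel-< m n lt = ≰⇒> λ n≤m → <⇒≱ lt (2^-mono-≤ n≤m)

2^-cancel-≤ : ∀ m n → 2 ^ m ≤ 2 ^ n → m ≤ n
2^-cancel-≤ m n le = ≮⇒≥ λ n<m → <⇒≱ (^-monoʳ-< 2 (s≤s (s≤s z≤n)) n<m) le

2^-injective : ∀ {m n} → 2 ^ m ≡ 2 ^ n → m ≡ n
2^-injective {m} {n} eq = ≤-antisym (2^-cancel-≤ m n (≤-reflexive eq)) (2^-cancel-≤ n m (≤-reflexive (sym eq)))

2∤1+2* : ∀ k → ¬ 2 ∣ 1 + 2 * k
2∤1+2* k d with ∣1⇒≡1 (∣m+n∣m⇒∣n (subst (2 ∣_) (+-comm 1 (2 * k)) d) (m∣m*n k))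
... | ()

[m*2^k]/2^k≡m : ∀ m k → (m * 2 ^ k) /2^ k ≡ m
[m*2^k]/2^k≡m m k = m*n/n≡m m (2 ^ k) {{m^n≢0 2 k}}

-- The attained power lies below `2 ^ suc e`, so its exponent is at most `e`; maximality gives the
-- other inequality.
poᴺ-unique : ∀ x e → 2 ^ e ≤ x + 1 → x + 1 < 2 ^ suc e → poᴺ x ≡ 2 ^ e
poᴺ-unique x e lo hi with poᴺ-attained x
... | n , eq , le = ≤-antisym
  (subst (_≤ 2 ^ e) (sym eq) (2^-mono-≤ (≤-pred (2^-cancel-< n (suc e) (≤-<-trans le hi)))))
  (poᴺ-greatest x e lo)

quoᴺ-pow : ∀ s r a b → s ≡ 2 ^ a → r ≡ 2 ^ b → a ≤ b → quoᴺ s r ≡ 2 ^ (b ∸ a)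
quoᴺ-pow s r a b sa rb a≤b with isPow₂? s ×-dec isPow₂? r ×-dec (s ≤? r)
-- The decision procedure returns some exponent `m` of `s`; injectivity of powers of two identifies
-- it with `a`.
... | yes ((m , sm) , _) with refl ← 2^-injective {m} {a} (trans (sym sm) sa) = begin
  r /2^ m                     ≡⟨ cong (_/2^ m) rb ⟩
  2 ^ b /2^ m                 ≡⟨ cong (λ n → 2 ^ n /2^ m) (sym (m∸n+n≡m a≤b)) ⟩
  2 ^ (b ∸ m + m) /2^ m       ≡⟨ cong (_/2^ m) (^-distribˡ-+-* 2 (b ∸ m) m) ⟩
  (2 ^ (b ∸ m) * 2 ^ m) /2^ m ≡⟨ [m*2^k]/2^k≡m (2 ^ (b ∸ m)) m ⟩
  2 ^ (b ∸ m)                 ∎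
  where open ≡-Reasoning
... | no ¬p = contradiction
  ((a , sa) , (b , rb) , subst (_≤ r) (sym sa) (subst (2 ^ a ≤_) (sym rb) (2^-mono-≤ a≤b))) ¬p

quoᴺ-zero : ∀ s r → ¬ (IsPow₂ s × IsPow₂ r × s ≤ r) → quoᴺ s r ≡ 0
quoᴺ-zero s r ¬p with isPow₂? s ×-dec isPow₂? r ×-dec (s ≤? r)
... | yes p = contradiction p ¬p
... | no  _ = refl

halfᴺ-even : ∀ k → halfᴺ (2 * k) ≡ k
halfᴺ-even k with 2 ∣? 2 * k
... | yes _ = trans (cong (_/ 2) (*-comm 2 k)) (m*n/n≡m k 2)
... | no ¬d = contradiction (m∣m*n k) ¬d

halfᴺ-odd : ∀ k → halfᴺ (1 + 2 * k) ≡ 0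
halfᴺ-odd k with 2 ∣? 1 + 2 * k
... | yes d = contradiction d (2∤1+2* k)
... | no  _ = refl

-- If the valuation exceeded `e`, then `2 ^ suc e` would divide the number, and cancelling `2 ^ e`
-- would make `1 + 2 * k` even.
ν₂-unique : ∀ e k → ν₂ (2 ^ e * (1 + 2 * k)) ≡ e
ν₂-unique e k = ≤-antisym (≮⇒≥ λ e<ν → 2∤1+2* k (2∣odd (∣-trans (2^∣ e<ν) (ν₂-divides n))))
                          (ν₂-greatest n e (m∣m*n _))
  where
  n = 2 ^ e * (1 + 2 * k)
  instance
    _ = m^n≢0 2 e
    n≢0 : NonZero n
    n≢0 = m*n≢0 (2 ^ e) (1 + 2 * k)
  2^∣ : e < ν₂ n → 2 ^ suc e ∣ 2 ^ ν₂ n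
  2^∣ e<ν = subst (λ j → 2 ^ suc e ∣ 2 ^ j) (m+[n∸m]≡n e<ν)
    (subst (2 ^ suc e ∣_) (sym (^-distribˡ-+-* 2 (suc e) (ν₂ n ∸ suc e))) (m∣m*n _))
  2∣odd : 2 ^ suc e ∣ n → 2 ∣ 1 + 2 * k
  2∣odd d = *-cancelˡ-∣ (2 ^ e) (subst (_∣ n) (*-comm 2 (2 ^ e)) d)

obstᴺ≡ : ∀ n .{{_ : NonZero n}} → obstᴺ n ≡ n /2^ ν₂ n
obstᴺ≡ (suc _) = refl

cofᴺ≡ : ∀ n .{{_ : NonZero n}} → cofᴺ n ≡ 2 ^ ν₂ n
cofᴺ≡ (suc _) = refl

2^*odd≢0 : ∀ e k → NonZero (2 ^ e * (1 + 2 * k))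
2^*odd≢0 e k = m*n≢0 (2 ^ e) (1 + 2 * k) {{m^n≢0 2 e}}

obstᴺ-2^*odd : ∀ e k → obstᴺ (2 ^ e * (1 + 2 * k)) ≡ 1 + 2 * k
obstᴺ-2^*odd e k = begin
  obstᴺ n                     ≡⟨ obstᴺ≡ n {{2^*odd≢0 e k}} ⟩
  n /2^ ν₂ n                  ≡⟨ cong (n /2^_) (ν₂-unique e k) ⟩
  n /2^ e                     ≡⟨ cong (_/2^ e) (*-comm (2 ^ e) (1 + 2 * k)) ⟩
  ((1 + 2 * k) * 2 ^ e) /2^ e ≡⟨ [m*2^k]/2^k≡m (1 + 2 * k) e ⟩
  1 + 2 * k                   ∎
  where
  open ≡-Reasoning
  n = 2 ^ e * (1 + 2 * k)

cofᴺ-2^*odd : ∀ e k → cofᴺ (2 ^ e * (1 + 2 * k)) ≡ 2 ^ e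
cofᴺ-2^*odd e k = trans (cofᴺ≡ _ {{2^*odd≢0 e k}}) (cong (2 ^_) (ν₂-unique e k))

-- Properties of all sufficiently large arguments

record Eventually (P : ℕ → Set) : Set where
  constructor eventually
  field
    start : ℕ
    holds : ∀ q → start ≤ q → P q

open Eventually

ev-map : ∀ {P Q : ℕ → Set} → (∀ {q} → P q → Q q) → Eventually P → Eventually Q
ev-map f (eventually N h) = eventually N λ q le → f (h q le)

ev-zip : ∀ {P Q R : ℕ → Set} → (∀ {q} → P q → Q q → R q) → Eventually P → Eventually Q → Eventually R
ev-zip f (eventually M g) (eventually N h) =
  eventually (M ⊔ N) λ q le → f (g q (m⊔n≤o⇒m≤o M N le)) (h q (m⊔n≤o⇒n≤o M N le))

ev-zip₃ : ∀ {P Q R S : ℕ → Set} → (∀ {q} → P q → Q q → R q → S q) →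
          Eventually P → Eventually Q → Eventually R → Eventually S
ev-zip₃ f p q r = ev-zip (λ x g → g x) p (ev-zip (λ y z x → f x y z) q r)

ev-all : ∀ {P : ℕ → Set} → (∀ q → P q) → Eventually P
ev-all h = eventually 0 λ q _ → h q

ev-≥ : ∀ N → Eventually (N ≤_)
ev-≥ N = eventually N λ _ le → le

ev-clash : ∀ {P Q : ℕ → Set} → (∀ {q} → P q → Q q → ⊥) → Eventually P → Eventually Q → ⊥
ev-clash {P} {Q} f p q with ev-zip {R = λ _ → ⊥} f p q
... | eventually N h = h N ≤-refl

-- Polynomial germs and their ring operations

pow : ℕ → ℤ
pow n = + (2 ^ n)

pow-+ : ∀ m n → pow (m + n) ≡ pow m ℤ.* pow n
pow-+ m n = trans (cong +_ (^-distribˡ-+-* 2 m n)) (ℤP.pos-* (2 ^ m) (2 ^ n))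

[q∸[m+n]]+n≡q∸m : ∀ m n {q} → m + n ≤ q → q ∸ (m + n) + n ≡ q ∸ m
[q∸[m+n]]+n≡q∸m m n {q} le = begin
  q ∸ (m + n) + n ≡⟨ cong (_+ n) (sym (∸-+-assoc q m n)) ⟩
  q ∸ m ∸ n + n   ≡⟨ m∸n+n≡m (m+n≤o⇒m≤o∸n n (subst (_≤ q) (+-comm m n) le)) ⟩
  q ∸ m           ∎
  where open ≡-Reasoning

-- Enlarges the offset of a Horner step, at the price of a constant power of two that moves into the
-- tail.
pow-∸-split : ∀ m n {q} → m + n ≤ q → pow (q ∸ m) ≡ pow (q ∸ (m + n)) ℤ.* pow n
pow-∸-split m n {q} le = trans (cong pow (sym ([q∸[m+n]]+n≡q∸m m n le))) (pow-+ (q ∸ (m + n)) n)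

-- The polynomials in U = 2 ^ q with dyadic coefficients, as germs at infinity:
-- writing U = 2 ^ m * 2 ^ (q ∸ m) absorbs the denominators, so that all
-- Horner coefficients are integers.
data Poly (f : ℕ → ℤ) : Set where
  null   : Eventually (λ q → f q ≡ 0ℤ) → Poly f
  horner : ∀ m a {g} → Poly g → Eventually (λ q → f q ≡ a ℤ.+ pow (q ∸ m) ℤ.* g q) → Poly f

Poly-cong : ∀ {f g} → Eventually (λ q → f q ≡ g q) → Poly g → Poly f
Poly-cong eq (null g≡)         = null (ev-zip trans eq g≡)
Poly-cong eq (horner m a p g≡) = horner m a p (ev-zip trans eq g≡)

Poly-const : ∀ a → Poly (λ _ → a)
Poly-const a = horner 0 a (null (ev-all λ _ → refl)) (ev-all λ q → sym (lemma a (pow q)))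
  where
  lemma : ∀ a u → a ℤ.+ u ℤ.* 0ℤ ≡ a
  lemma = ℤSolver.solve-∀

Poly-shift : ∀ m {f} → Poly f → Poly (λ q → pow (q ∸ m) ℤ.* f q)
Poly-shift m p = horner m 0ℤ p (ev-all λ _ → sym (ℤP.+-identityˡ _))

Poly-scale : ∀ b {f} → Poly f → Poly (λ q → b ℤ.* f q)
Poly-scale b (null f≡) = null (ev-map (λ eq → trans (cong (b ℤ.*_) eq) (ℤP.*-zeroʳ b)) f≡)
Poly-scale b (horner m a {g} p f≡) = horner m (b ℤ.* a) (Poly-scale b p)
  (ev-map (λ {q} eq → trans (cong (b ℤ.*_) eq) (lemma b a (pow (q ∸ m)) (g q))) f≡)
  where
  lemma : ∀ b a u g → b ℤ.* (a ℤ.+ u ℤ.* g) ≡ b ℤ.* a ℤ.+ u ℤ.* (b ℤ.* g)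
  lemma = ℤSolver.solve-∀

-- Bringing two Horner steps to the common offset `m + m′` multiplies their tails by different
-- powers of two. The recursion therefore has to treat linear combinations and not only sums.
Poly-linear : ∀ b b′ {f f′} → Poly f → Poly f′ → Poly (λ q → b ℤ.* f q ℤ.+ b′ ℤ.* f′ q)
Poly-linear b b′ {f} {f′} (null f≡) p′ = Poly-cong
  (ev-map (λ {q} eq → trans (cong (λ x → b ℤ.* x ℤ.+ b′ ℤ.* f′ q) eq) (lemma b (b′ ℤ.* f′ q))) f≡)
  (Poly-scale b′ p′)
  where
  lemma : ∀ b x → b ℤ.* 0ℤ ℤ.+ x ≡ x
  lemma = ℤSolver.solve-∀
Poly-linear b b′ {f} p@(horner _ _ _ _) (null f′≡) = Poly-cong
  (ev-map (λ {q} eq → trans (cong (λ x → b ℤ.* f q ℤ.+ b′ ℤ.* x) eq) (lemma b′ (b ℤ.* f q))) f′≡)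
  (Poly-scale b p)
  where
  lemma : ∀ b′ x → x ℤ.+ b′ ℤ.* 0ℤ ≡ x
  lemma = ℤSolver.solve-∀
Poly-linear b b′ (horner m a {g} p f≡) (horner m′ a′ {g′} p′ f′≡) =
  horner (m + m′) (b ℤ.* a ℤ.+ b′ ℤ.* a′) (Poly-linear (b ℤ.* pow m′) (b′ ℤ.* pow m) p p′)
    (ev-zip₃ (λ {q} eq eq′ le → trans
        (cong₂ (λ x y → b ℤ.* x ℤ.+ b′ ℤ.* y)
          (trans eq (cong (λ u → a ℤ.+ u ℤ.* g q) (pow-∸-split m m′ le)))
          (trans eq′ (cong (λ u → a′ ℤ.+ u ℤ.* g′ q) (split′ le))))
        (lemma b b′ a a′ (pow (q ∸ (m + m′))) (pow m) (pow m′) (g q) (g′ q)))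
      f≡ f′≡ (ev-≥ (m + m′)))
  where
  split′ : ∀ {q} → m + m′ ≤ q → pow (q ∸ m′) ≡ pow (q ∸ (m + m′)) ℤ.* pow m
  split′ {q} le = subst (λ n → pow (q ∸ m′) ≡ pow (q ∸ n) ℤ.* pow m) (+-comm m′ m)
    (pow-∸-split m′ m (subst (_≤ q) (+-comm m m′) le))
  lemma : ∀ b b′ a a′ u v v′ g g′ →
          b ℤ.* (a ℤ.+ (u ℤ.* v′) ℤ.* g) ℤ.+ b′ ℤ.* (a′ ℤ.+ (u ℤ.* v) ℤ.* g′)
          ≡ (b ℤ.* a ℤ.+ b′ ℤ.* a′) ℤ.+ u ℤ.* ((b ℤ.* v′) ℤ.* g ℤ.+ (b′ ℤ.* v) ℤ.* g′)
  lemma = ℤSolver.solve-∀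

Poly-+ : ∀ {f g} → Poly f → Poly g → Poly (λ q → f q ℤ.+ g q)
Poly-+ {f} {g} p p′ = Poly-cong
  (ev-all λ q → sym (cong₂ ℤ._+_ (ℤP.*-identityˡ (f q)) (ℤP.*-identityˡ (g q)))) (Poly-linear 1ℤ 1ℤ p p′)

Poly-* : ∀ {f g} → Poly f → Poly g → Poly (λ q → f q ℤ.* g q)
Poly-* {g = h} (null f≡) _ = null (ev-map (λ {q} eq → cong (ℤ._* h q) eq) f≡)
Poly-* {g = h} (horner m a {g} p f≡) p′ =
  Poly-cong (ev-map (λ {q} eq → trans (cong (ℤ._* h q) eq) (lemma a (pow (q ∸ m)) (g q) (h q))) f≡)
    (Poly-+ (Poly-scale a p′) (Poly-shift m (Poly-* p p′)))
  where
  lemma : ∀ a u g h → (a ℤ.+ u ℤ.* g) ℤ.* h ≡ a ℤ.* h ℤ.+ u ℤ.* (g ℤ.* h)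
  lemma = ℤSolver.solve-∀

Poly-minus : ∀ {f g} → Poly f → Poly g → Poly (λ q → f q ℤ.- g q)
Poly-minus {f} {g} p p′ = Poly-cong
  (ev-all λ q → sym (cong₂ ℤ._+_ (ℤP.*-identityˡ (f q)) (ℤP.-1*i≡-i (g q)))) (Poly-linear 1ℤ ℤ.-1ℤ p p′)

-- Eventual sign

data EventualSign (f : ℕ → ℤ) : Set where
  zero     : Eventually (λ q → f q ≡ 0ℤ) → EventualSign f
  positive : Eventually (λ q → 0ℤ ℤ.< f q) → EventualSign f
  negative : Eventually (λ q → f q ℤ.< 0ℤ) → EventualSign f

ev-pow> : ∀ N m → Eventually (λ q → N < 2 ^ (q ∸ m))
ev-pow> N m = eventually (N + m) λ q le → ≤-<-trans (m+n≤o⇒m≤o∸n N le) (n<2^n (q ∸ m))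

0<a+n : ∀ a {n} → ∣ a ∣ < n → 0ℤ ℤ.< a ℤ.+ + n
0<a+n (+ k)    {n} lt = ℤ.+<+ (≤-trans (≤-trans (s≤s z≤n) lt) (m≤n+m n k))
0<a+n -[1+ k ] {n} lt = subst (ℤ._< -[1+ k ] ℤ.+ + n) (ℤP.+-inverseˡ (+ suc k))
  (ℤP.+-monoʳ-< -[1+ k ] (ℤ.+<+ lt))

0<g⇒n≤n*g : ∀ n {g} → 0ℤ ℤ.< g → + n ℤ.≤ + n ℤ.* g
0<g⇒n≤n*g n {g} 0<g = subst (ℤ._≤ + n ℤ.* g) (ℤP.*-identityʳ (+ n))
  (ℤP.*-monoˡ-≤-nonNeg (+ n) (ℤP.i<j⇒suc[i]≤j 0<g))

-- A positive integer `g` is at least 1, so `n * g` is at least `n` and outweighs `a`.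
0<a+n*g : ∀ a n g → ∣ a ∣ < n → 0ℤ ℤ.< g → 0ℤ ℤ.< a ℤ.+ + n ℤ.* g
0<a+n*g a n g lt 0<g = ℤP.<-≤-trans (0<a+n a lt) (ℤP.+-monoʳ-≤ a (0<g⇒n≤n*g n 0<g))

a+n*g<0 : ∀ a n g → ∣ a ∣ < n → g ℤ.< 0ℤ → a ℤ.+ + n ℤ.* g ℤ.< 0ℤ
a+n*g<0 a n g lt g<0 = ℤP.neg-cancel-< (subst (0ℤ ℤ.<_) (lemma a (+ n) g)
    (0<a+n*g (ℤ.- a) n (ℤ.- g) (subst (_< n) (sym (ℤP.∣-i∣≡∣i∣ a)) lt) (ℤP.neg-mono-< g<0)))
  where
  lemma : ∀ a n g → ℤ.- a ℤ.+ n ℤ.* (ℤ.- g) ≡ ℤ.- (a ℤ.+ n ℤ.* g)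
  lemma = ℤSolver.solve-∀

≡a+u*0 : ∀ {f a u g} → f ≡ a ℤ.+ u ℤ.* g → g ≡ 0ℤ → f ≡ a
≡a+u*0 {a = a} {u} refl refl = trans (cong (λ x → a ℤ.+ x) (ℤP.*-zeroʳ u)) (ℤP.+-identityʳ a)

-- The tail decides as soon as `2 ^ (q ∸ m)` exceeds the absolute value of `a`. Only when the tail
-- vanishes does the sign of `a` count.
eventualSign : ∀ {f} → Poly f → EventualSign f
eventualSign (null f≡) = zero f≡
eventualSign (horner m a {g} p f≡) with eventualSign p
... | positive 0<g = positive (ev-zip₃ (λ {q} eq 0<g lt →
        subst (0ℤ ℤ.<_) (sym eq) (0<a+n*g a (2 ^ (q ∸ m)) (g q) lt 0<g)) f≡ 0<g (ev-pow> ∣ a ∣ m))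
... | negative g<0 = negative (ev-zip₃ (λ {q} eq g<0 lt →
        subst (ℤ._< 0ℤ) (sym eq) (a+n*g<0 a (2 ^ (q ∸ m)) (g q) lt g<0)) f≡ g<0 (ev-pow> ∣ a ∣ m))
... | zero g≡0 with ℤP.<-cmp a 0ℤ | ev-zip (λ {q} → ≡a+u*0 {u = pow (q ∸ m)}) f≡ g≡0
...   | tri≈ _ refl _ | f≡a = zero f≡a
...   | tri< a<0 _ _ | f≡a = negative (ev-map (λ eq → subst (ℤ._< 0ℤ) (sym eq) a<0) f≡a)
...   | tri> _ _ 0<a | f≡a = positive (ev-map (λ eq → subst (0ℤ ℤ.<_) (sym eq) 0<a) f≡a)

0≤+n : ∀ {n} → ¬ (+ n) ℤ.< 0ℤ
0≤+n (ℤ.+<+ ())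

-- Affine exponents

-- The germs k + n * q with k an integer and n a natural number.
data Affine (e : ℕ → ℕ) : Set where
  constant : ∀ k → Eventually (λ q → e q ≡ k) → Affine e
  step     : ∀ m {e′} → Affine e′ → Eventually (λ q → e q ≡ q ∸ m + e′ q) → Affine e

Affine-+ : ∀ k {e} → Affine e → Affine (λ q → k + e q)
Affine-+ k (constant k′ e≡)     = constant (k + k′) (ev-map (cong (λ n → k + n)) e≡)
Affine-+ k (step m {e′} A e≡) = step m (Affine-+ k A)
  (ev-map (λ {q} eq → trans (cong (λ n → k + n) eq) (lemma k (q ∸ m) (e′ q))) e≡)
  where
  lemma : ∀ k r e → k + (r + e) ≡ r + (k + e)
  lemma = solve-∀

-- In the case of two steps, cancelling the common `q ∸ (m + m′)` leaves `m′` on the left and `m` on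
-- the right. The added constants `k` and `k′` are there to take these up, so that the recursion
-- closes.
Affine-[+]∸[+] : ∀ k k′ {e e′} → Affine e → Affine e′ → Affine (λ q → (k + e q) ∸ (k′ + e′ q))
Affine-[+]∸[+] k k′ (constant l e≡) (constant l′ e′≡) =
  constant ((k + l) ∸ (k′ + l′)) (ev-zip (cong₂ λ x y → (k + x) ∸ (k′ + y)) e≡ e′≡)
-- The subtrahend grows with `q` and eventually passes the constant, so the truncated difference
-- becomes 0.
Affine-[+]∸[+] k k′ (constant l e≡) (step m {d′} A e′≡) = constant 0
  (ev-zip₃ (λ {q} eq eq′ le → m≤n⇒m∸n≡0 (subst (λ n → k + n ≤ _) (sym eq)
    (subst (λ n → k + l ≤ k′ + n) (sym eq′)
      (≤-trans (m+n≤o⇒m≤o∸n (k + l) le) (≤-trans (m≤m+n (q ∸ m) (d′ q)) (m≤n+m _ k′))))))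
    e≡ e′≡ (ev-≥ (k + l + m)))
-- The constant subtrahend `k′ + l` is absorbed into the offset `m`.
Affine-[+]∸[+] k k′ (step m {d} A e≡) (constant l e′≡) = step (m + (k′ + l)) (Affine-+ k A)
  (ev-zip₃ (λ {q} eq eq′ le → begin
    _                                                      ≡⟨ cong₂ (λ x y → (k + x) ∸ (k′ + y)) eq eq′ ⟩
    (k + (q ∸ m + d q)) ∸ (k′ + l)
      ≡⟨ cong (λ r → (k + (r + d q)) ∸ (k′ + l)) (sym ([q∸[m+n]]+n≡q∸m m (k′ + l) le)) ⟩
    (k + (q ∸ (m + (k′ + l)) + (k′ + l) + d q)) ∸ (k′ + l)
      ≡⟨ cong (_∸ (k′ + l)) (lemma k (q ∸ (m + (k′ + l))) (k′ + l) (d q)) ⟩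
    q ∸ (m + (k′ + l)) + (k + d q) + (k′ + l) ∸ (k′ + l)   ≡⟨ m+n∸n≡m _ (k′ + l) ⟩
    q ∸ (m + (k′ + l)) + (k + d q)                         ∎) e≡ e′≡ (ev-≥ (m + (k′ + l))))
  where
  open ≡-Reasoning
  lemma : ∀ k r s d → k + (r + s + d) ≡ r + (k + d) + s
  lemma = solve-∀
Affine-[+]∸[+] k k′ (step m {d} A e≡) (step m′ {d′} A′ e′≡)
  with Affine-[+]∸[+] (k + m′) (k′ + m) A A′
... | A″ = Affine-cong (ev-zip₃ (λ {q} eq eq′ le → begin
    _                                                  ≡⟨ cong₂ (λ x y → (k + x) ∸ (k′ + y)) eq eq′ ⟩
    (k + (q ∸ m + d q)) ∸ (k′ + (q ∸ m′ + d′ q))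
      ≡⟨ cong₂ (λ x y → (k + (x + d q)) ∸ (k′ + (y + d′ q)))
           (sym ([q∸[m+n]]+n≡q∸m m m′ le))
           (sym (trans (cong (λ n → q ∸ n + m) (+-comm m m′))
             ([q∸[m+n]]+n≡q∸m m′ m (subst (_≤ q) (+-comm m m′) le)))) ⟩
    (k + (q ∸ (m + m′) + m′ + d q)) ∸ (k′ + (q ∸ (m + m′) + m + d′ q))
      ≡⟨ cong₂ _∸_ (lemma k (q ∸ (m + m′)) m′ (d q)) (lemma k′ (q ∸ (m + m′)) m (d′ q)) ⟩
    (q ∸ (m + m′) + (k + m′ + d q)) ∸ (q ∸ (m + m′) + (k′ + m + d′ q))
      ≡⟨ [m+n]∸[m+o]≡n∸o (q ∸ (m + m′)) _ _ ⟩
    (k + m′ + d q) ∸ (k′ + m + d′ q)                   ∎) e≡ e′≡ (ev-≥ (m + m′))) A″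
  where
  open ≡-Reasoning
  lemma : ∀ k r s d → k + (r + s + d) ≡ r + (k + s + d)
  lemma = solve-∀
  Affine-cong : ∀ {e e′} → Eventually (λ q → e q ≡ e′ q) → Affine e′ → Affine e
  Affine-cong eq (constant k e≡) = constant k (ev-zip trans eq e≡)
  Affine-cong eq (step m A e≡)   = step m A (ev-zip trans eq e≡)

Affine-∸ : ∀ {e e′} → Affine e → Affine e′ → Affine (λ q → e q ∸ e′ q)
Affine-∸ = Affine-[+]∸[+] 0 0

Affine-pred : ∀ {e} → Affine e → Affine (λ q → e q ∸ 1)
Affine-pred A = Affine-∸ A (constant 1 (ev-all λ _ → refl))

-- Serves to decide whether a factor 2 can be split off from `2 ^ e q`; positivity is written as a
-- successor so that the power unfolds.
Affine-zero? : ∀ {e} → Affine e →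
               Eventually (λ q → e q ≡ 0) ⊎ Eventually (λ q → e q ≡ suc (e q ∸ 1))
Affine-zero? (constant zero e≡)    = inj₁ e≡
Affine-zero? (constant (suc k) e≡) = inj₂ (ev-map (λ eq → trans eq (cong (λ n → suc (n ∸ 1)) (sym eq))) e≡)
Affine-zero? {e} (step m {e′} A e≡) = inj₂ (ev-zip (λ {q} eq le →
  sym (m+[n∸m]≡n (subst (1 ≤_) (sym eq) (≤-trans (m+n≤o⇒m≤o∸n 1 le) (m≤m+n (q ∸ m) (e′ q))))))
  e≡ (ev-≥ (1 + m)))

-- Each summand `q ∸ m` of the exponent becomes a Horner step with constant term 0.
Poly-pow : ∀ {e} → Affine e → Poly (λ q → pow (e q))
Poly-pow (constant k e≡)    = Poly-cong (ev-map (cong pow) e≡) (Poly-const (pow k))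
Poly-pow (step m {e′} A e≡) =
  Poly-cong (ev-map (λ {q} eq → trans (cong pow eq) (pow-+ (q ∸ m) (e′ q))) e≡) (Poly-shift m (Poly-pow A))

-- Enclosure between consecutive powers of two

0<j⇒i≤i+j : ∀ i {j} → 0ℤ ℤ.< j → i ℤ.≤ i ℤ.+ j
0<j⇒i≤i+j i {j} 0<j = subst (ℤ._≤ i ℤ.+ j) (ℤP.+-identityʳ i) (ℤP.+-monoʳ-≤ i (ℤP.<⇒≤ 0<j))

∣a∣<n⇒a<n : ∀ a {n} → ∣ a ∣ < n → a ℤ.< + n
∣a∣<n⇒a<n (+ _)    lt = ℤ.+<+ lt
∣a∣<n⇒a<n -[1+ _ ] lt = ℤ.-<+

a+2^r*g<2^ : ∀ a r e {g} → ∣ a ∣ < 2 ^ r → g ℤ.< pow (suc e) → a ℤ.+ pow r ℤ.* g ℤ.< pow (suc (r + e))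
a+2^r*g<2^ a r e {g} lt g< = begin-strict
  a ℤ.+ pow r ℤ.* g       <⟨ ℤP.+-monoˡ-< (pow r ℤ.* g) (∣a∣<n⇒a<n a lt) ⟩
  pow r ℤ.+ pow r ℤ.* g   ≡⟨ lemma (pow r) g ⟩
  pow r ℤ.* ℤ.suc g       ≤⟨ ℤP.*-monoˡ-≤-nonNeg (pow r) (ℤP.i<j⇒suc[i]≤j g<) ⟩
  pow r ℤ.* pow (suc e)   ≡⟨ sym (pow-+ r (suc e)) ⟩
  pow (r + suc e)         ≡⟨ cong pow (+-suc r e) ⟩
  pow (suc (r + e))       ∎
  where
  open ℤP.≤-Reasoning
  lemma : ∀ u g → u ℤ.+ u ℤ.* g ≡ u ℤ.* (1ℤ ℤ.+ g)
  lemma = ℤSolver.solve-∀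

-- The strict gap between `g` and `2 ^ e` is worth at least `2 ^ r` after scaling, which compensates
-- a negative `a`.
2^≤a+2^r*g : ∀ a r e {g} → ∣ a ∣ < 2 ^ r → 0ℤ ℤ.< g ℤ.- pow e → pow (r + e) ℤ.≤ a ℤ.+ pow r ℤ.* g
2^≤a+2^r*g a r e {g} lt 0<d = begin
  pow (r + e)                                            ≡⟨ pow-+ r e ⟩
  pow r ℤ.* pow e
    ≤⟨ 0<j⇒i≤i+j (pow r ℤ.* pow e) (0<a+n*g a (2 ^ r) (g ℤ.- pow e) lt 0<d) ⟩
  pow r ℤ.* pow e ℤ.+ (a ℤ.+ pow r ℤ.* (g ℤ.- pow e))    ≡⟨ lemma a (pow r) g (pow e) ⟩
  a ℤ.+ pow r ℤ.* g                                      ∎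
  where
  open ℤP.≤-Reasoning
  lemma : ∀ a u g w → u ℤ.* w ℤ.+ (a ℤ.+ u ℤ.* (g ℤ.- w)) ≡ a ℤ.+ u ℤ.* g
  lemma = ℤSolver.solve-∀

pow-suc : ∀ n → pow (suc n) ≡ pow n ℤ.+ pow n
pow-suc n = trans (cong (λ k → + (2 ^ n + k)) (+-identityʳ (2 ^ n))) (ℤP.pos-+ (2 ^ n) (2 ^ n))

-- One of the two halves of `2 ^ suc n` absorbs `a`; the other remains.
2^≤a+2^[1+] : ∀ a n → ∣ a ∣ < 2 ^ n → pow n ℤ.≤ a ℤ.+ pow (suc n)
2^≤a+2^[1+] a n lt = subst (pow n ℤ.≤_)
  (trans (lemma a (pow n)) (cong (λ x → a ℤ.+ x) (sym (pow-suc n)))) (0<j⇒i≤i+j (pow n) (0<a+n a lt))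
  where
  lemma : ∀ a u → u ℤ.+ (a ℤ.+ u) ≡ a ℤ.+ (u ℤ.+ u)
  lemma = ℤSolver.solve-∀

log₂-bounds : ∀ n → ∃[ e ] (2 ^ e ≤ suc n × suc n < 2 ^ suc e)
log₂-bounds n with poᴺ-attained n
... | e , eq , le = e , subst (2 ^ e ≤_) (+-comm n 1) le ,
  ≰⇒> λ le′ → <⇒≱ (n<1+n e) (2^-cancel-≤ (suc e) e
    (subst (2 ^ suc e ≤_) eq (poᴺ-greatest n (suc e) (subst (2 ^ suc e ≤_) (+-comm 1 n) le′))))

ev-const : ∀ {A : Set} → Eventually (λ _ → A) → A
ev-const (eventually N h) = h N ≤-refl

record DyadicBounds (f : ℕ → ℤ) : Set where
  constructor bounds
  field
    {exponent} : ℕ → ℕ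
    affine     : Affine exponent
    lower      : Eventually (λ q → pow (exponent q) ℤ.≤ f q)
    upper      : Eventually (λ q → f q ℤ.< pow (suc (exponent q)))

-- If `e` encloses a positive tail `g`, then `q ∸ m + e` encloses the whole, since `a` is negligible
-- against `2 ^ (q ∸ m)`. The only exception is a tail equal to `2 ^ e` together with a negative
-- `a`.
dyadicBounds : ∀ {f} → Poly f → Eventually (λ q → 0ℤ ℤ.< f q) → DyadicBounds f
dyadicBounds (null f≡0) 0<f = ⊥-elim (ev-clash (λ eq lt → ℤP.<-irrefl (sym eq) lt) f≡0 0<f)
dyadicBounds {f} (horner m a {g} p f≡) 0<f with eventualSign p
... | negative g<0 = ⊥-elim (ev-clash ℤP.<-asym 0<f (ev-zip₃ (λ {q} eq g<0 lt →
        subst (ℤ._< 0ℤ) (sym eq) (a+n*g<0 a (2 ^ (q ∸ m)) (g q) lt g<0)) f≡ g<0 (ev-pow> ∣ a ∣ m)))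
... | zero g≡0 = fromConstant a (ev-const (ev-zip (subst (0ℤ ℤ.<_)) f≡a 0<f)) f≡a
  where
  f≡a = ev-zip (λ {q} → ≡a+u*0 {u = pow (q ∸ m)}) f≡ g≡0
  fromConstant : ∀ a → 0ℤ ℤ.< a → Eventually (λ q → f q ≡ a) → DyadicBounds f
  fromConstant (+ suc k) _ f≡a with log₂-bounds k
  ... | e , lo , hi = bounds (constant e (ev-all λ _ → refl))
    (ev-map (λ eq → subst (pow e ℤ.≤_) (sym eq) (ℤ.+≤+ lo)) f≡a)
    (ev-map (λ eq → subst (ℤ._< pow (suc e)) (sym eq) (ℤ.+<+ hi)) f≡a)
  fromConstant (+ zero) (ℤ.+<+ ()) _
... | positive 0<g with dyadicBounds p 0<g
-- The upper bound always carries over. The lower one depends on whether `g` lies strictly above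
-- `2 ^ e`, which the eventual sign of the difference settles.
...   | bounds {e} A lo hi = split (eventualSign (Poly-minus p (Poly-pow A)))
  where
  hi′ : Eventually (λ q → f q ℤ.< pow (suc (q ∸ m + e q)))
  hi′ = ev-zip₃ (λ {q} eq lt g< → subst (ℤ._< pow (suc (q ∸ m + e q))) (sym eq)
          (a+2^r*g<2^ a (q ∸ m) (e q) lt g<)) f≡ (ev-pow> ∣ a ∣ m) hi

  fromPow : ∀ a → Eventually (λ q → f q ≡ a ℤ.+ pow (q ∸ m + e q)) → DyadicBounds f
  fromPow (+ k) f≡ = bounds (step m A (ev-all λ _ → refl))
    (ev-map (λ {q} eq → subst (pow (q ∸ m + e q) ℤ.≤_) (sym eq) (ℤ.+≤+ (m≤n+m _ k))) f≡) hi′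
  -- a + 2 ^ E with a < 0 lies just below 2 ^ E, so the exponent drops to E ∸ 1.
  fromPow a@(-[1+ k ]) f≡ = bounds (step (m + 1) A (ev-all λ _ → refl))
    (ev-zip (λ {q} eq lt → subst (pow (q ∸ (m + 1) + e q) ℤ.≤_) (sym eq)
      (2^≤a+2^[1+] a (q ∸ (m + 1) + e q) (<-≤-trans lt (2^-mono-≤ (m≤m+n (q ∸ (m + 1)) (e q))))))
      f≡′ (ev-pow> ∣ a ∣ (m + 1)))
    (ev-map (λ {q} eq → subst (ℤ._< pow (suc (q ∸ (m + 1) + e q))) (sym eq)
      (subst (a ℤ.+ pow (suc (q ∸ (m + 1) + e q)) ℤ.<_) (ℤP.+-identityˡ _)
        (ℤP.+-monoˡ-< (pow (suc (q ∸ (m + 1) + e q))) {a} {0ℤ} ℤ.-<+))) f≡′)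
    where
    f≡′ : Eventually (λ q → f q ≡ a ℤ.+ pow (suc (q ∸ (m + 1) + e q)))
    f≡′ = ev-zip (λ {q} eq le → trans eq (cong (λ r → a ℤ.+ pow (r + e q))
            (trans (sym ([q∸[m+n]]+n≡q∸m m 1 le)) (+-comm _ 1)))) f≡ (ev-≥ (m + 1))

  split : EventualSign (λ q → g q ℤ.- pow (e q)) → DyadicBounds f
  split (negative d<0) = ⊥-elim (ev-clash (λ lt le → ℤP.<⇒≱ lt (ℤP.i≤j⇒0≤j-i le)) d<0 lo)
  split (positive 0<d) = bounds (step m A (ev-all λ _ → refl))
    (ev-zip₃ (λ {q} eq lt 0<d → subst (pow (q ∸ m + e q) ℤ.≤_) (sym eq)
      (2^≤a+2^r*g a (q ∸ m) (e q) lt 0<d)) f≡ (ev-pow> ∣ a ∣ m) 0<d) hi′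
  split (zero d≡0) = fromPow a (ev-zip (λ {q} eq d≡0 → trans eq (cong (λ x → a ℤ.+ x)
    (trans (cong (pow (q ∸ m) ℤ.*_) (ℤP.i-j≡0⇒i≡j (g q) (pow (e q)) d≡0)) (sym (pow-+ (q ∸ m) (e q))))))
    f≡ d≡0)

-- Splitting off the power of two

parity : ∀ n → (∃[ k ] n ≡ 2 * k) ⊎ (∃[ k ] n ≡ 1 + 2 * k)
parity zero = inj₁ (0 , refl)
parity (suc n) with parity n
... | inj₁ (k , refl) = inj₂ (k , refl)
... | inj₂ (k , refl) = inj₁ (suc k , cong suc (sym (+-suc k (k + 0))))

-- Halving strictly decreases a positive even number, so well-founded recursion ends at an odd one.
odd-part-ℕ : ∀ n → ∃[ e ] ∃[ k ] suc n ≡ 2 ^ e * (1 + 2 * k)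
odd-part-ℕ = <-rec _ λ n rec → go n rec (parity (suc n))
  where
  go : ∀ n → (∀ {m} → m < n → ∃[ e ] ∃[ k ] suc m ≡ 2 ^ e * (1 + 2 * k)) →
       (∃[ k ] suc n ≡ 2 * k) ⊎ (∃[ k ] suc n ≡ 1 + 2 * k) →
       ∃[ e ] ∃[ k ] suc n ≡ 2 ^ e * (1 + 2 * k)
  go n rec (inj₂ (k , eq))     = 0 , k , trans eq (sym (*-identityˡ _))
  go n rec (inj₁ (zero , ()))
  go n rec (inj₁ (suc k , eq)) with rec (≤-pred (subst (suc (suc k) ≤_) (sym eq)
                                      (subst (suc (suc k) ≤_) (lemma k) (m≤m+n (suc (suc k)) k))))
    where
    lemma : ∀ k → suc (suc k) + k ≡ 2 * suc k
    lemma = solve-∀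
  ... | e , j , eq′ = suc e , j , trans eq (trans (cong (2 *_) eq′) (sym (*-assoc 2 (2 ^ e) _)))

odd-part-ℤ : ∀ a → ¬ a ≡ 0ℤ → ∃[ e ] Σ[ b ∈ ℤ ] a ≡ pow e ℤ.* (1ℤ ℤ.+ + 2 ℤ.* b)
odd-part-ℤ (+ zero)  a≢0 = contradiction refl a≢0
odd-part-ℤ (+ suc n) _ with odd-part-ℕ n
... | e , k , eq = e , + k , trans (cong +_ eq) (trans (ℤP.pos-* (2 ^ e) _)
        (cong (pow e ℤ.*_) (trans (ℤP.pos-+ 1 (2 * k)) (cong (λ x → 1ℤ ℤ.+ x) (ℤP.pos-* 2 k)))))
odd-part-ℤ -[1+ n ] _ with odd-part-ℤ (+ suc n) (λ ())
-- The negative of an odd number is odd: `-(1 + 2b) = 1 + 2(-b - 1)`.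
... | e , b , eq = e , ℤ.- b ℤ.- 1ℤ , trans (cong ℤ.-_ eq) (lemma (pow e) b)
  where
  lemma : ∀ u b → ℤ.- (u ℤ.* (1ℤ ℤ.+ + 2 ℤ.* b)) ≡ u ℤ.* (1ℤ ℤ.+ + 2 ℤ.* (ℤ.- b ℤ.- 1ℤ))
  lemma = ℤSolver.solve-∀

record OddPart (f : ℕ → ℤ) : Set where
  constructor oddPart
  field
    {exponent} : ℕ → ℕ
    {half-odd} : ℕ → ℤ
    affine     : Affine exponent
    poly       : Poly half-odd
    factors    : Eventually (λ q → f q ≡ pow (exponent q) ℤ.* (1ℤ ℤ.+ + 2 ℤ.* half-odd q))

-- A nonzero `a` fixes the valuation, because the rest is eventually divisible by a higher power of
-- two. If `a` is 0, the factor `2 ^ (q ∸ m)` joins the exponent found for the tail.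
zero-or-oddPart : ∀ {f} → Poly f → Eventually (λ q → f q ≡ 0ℤ) ⊎ OddPart f
zero-or-oddPart (null f≡0) = inj₁ f≡0
zero-or-oddPart {f} (horner m a {g} p f≡) with a ℤP.≟ 0ℤ
... | no a≢0 with odd-part-ℤ a a≢0
...   | ν , b , refl = inj₂ (oddPart (constant ν (ev-all λ _ → refl))
          (Poly-+ (Poly-const b) (Poly-shift (m + suc ν) p))
          (ev-zip (λ {q} eq le → trans eq (trans
            (cong (λ u → a ℤ.+ u ℤ.* g q) (trans (pow-∸-split m (suc ν) le)
              (cong (pow (q ∸ (m + suc ν)) ℤ.*_) (pow-suc ν))))
            (lemma (pow ν) b (pow (q ∸ (m + suc ν))) (g q)))) f≡ (ev-≥ (m + suc ν))))
  where
  lemma : ∀ w b u g → w ℤ.* (1ℤ ℤ.+ + 2 ℤ.* b) ℤ.+ (u ℤ.* (w ℤ.+ w)) ℤ.* g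
                    ≡ w ℤ.* (1ℤ ℤ.+ + 2 ℤ.* (b ℤ.+ u ℤ.* g))
  lemma = ℤSolver.solve-∀
zero-or-oddPart {f} (horner m a {g} p f≡) | yes refl with zero-or-oddPart p
... | inj₁ g≡0 = inj₁ (ev-zip (λ {q} → ≡a+u*0 {u = pow (q ∸ m)}) f≡ g≡0)
... | inj₂ (oddPart {e} {h} A p′ g≡) = inj₂ (oddPart (step m A (ev-all λ _ → refl)) p′
        (ev-zip (λ {q} eq eq′ → trans eq (trans (ℤP.+-identityˡ _) (trans (cong (pow (q ∸ m) ℤ.*_) eq′)
          (trans (sym (ℤP.*-assoc (pow (q ∸ m)) (pow (e q)) _))
            (cong (ℤ._* (1ℤ ℤ.+ + 2 ℤ.* h q)) (sym (pow-+ (q ∸ m) (e q)))))))) f≡ g≡))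

-- Carries the factorization from the integers to the naturals: a negative `z` would make
-- `1 + 2 * z`, and with it the product, negative.
+[2^e*odd] : ∀ {n} e z → + n ≡ pow e ℤ.* (1ℤ ℤ.+ + 2 ℤ.* z) → + ∣ z ∣ ≡ z × n ≡ 2 ^ e * (1 + 2 * ∣ z ∣)
+[2^e*odd] {n} e (+ k) eq = refl , ℤP.+-injective (trans eq (sym (begin
  + (2 ^ e * (1 + 2 * k))             ≡⟨ ℤP.pos-* (2 ^ e) (1 + 2 * k) ⟩
  pow e ℤ.* (1ℤ ℤ.+ + (2 * k))        ≡⟨ cong (λ x → pow e ℤ.* (1ℤ ℤ.+ x)) (ℤP.pos-* 2 k) ⟩
  pow e ℤ.* (1ℤ ℤ.+ + 2 ℤ.* + k)      ∎)))
  where open ≡-Reasoning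
+[2^e*odd] {n} e z@(-[1+ k ]) eq = contradiction (subst (ℤ._< 0ℤ) (sym eq)
    (subst (pow e ℤ.* odd ℤ.<_) (ℤP.*-zeroʳ (pow e))
      (ℤP.*-monoˡ-<-pos (pow e) {{ℤ.positive (ℤ.+<+ (m^n>0 2 e))}} odd<0))) 0≤+n
  where
  odd = 1ℤ ℤ.+ + 2 ℤ.* z
  odd<0 : odd ℤ.< 0ℤ
  odd<0 = subst (ℤ._< 0ℤ) (cong (λ n → 1ℤ ℤ.- (+ suc n)) (sym (+-suc k (k + 0)))) ℤ.-<+

-- Closure of natural-valued germs under the operations of the language

Polyᴺ : (ℕ → ℕ) → Set
Polyᴺ f = Poly (λ q → + f q)

Polyᴺ-cong : ∀ {f g} → Eventually (λ q → f q ≡ g q) → Polyᴺ g → Polyᴺ f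
Polyᴺ-cong eq = Poly-cong (ev-map (λ e → cong +_ e) eq)

Polyᴺ-zero : ∀ {f} → Eventually (λ q → f q ≡ 0) → Polyᴺ f
Polyᴺ-zero eq = null (ev-map (λ e → cong +_ e) eq)

Polyᴺ-+ : ∀ {f g} → Polyᴺ f → Polyᴺ g → Polyᴺ (λ q → f q + g q)
Polyᴺ-+ {f} {g} p p′ = Poly-cong (ev-all λ q → ℤP.pos-+ (f q) (g q)) (Poly-+ p p′)

Polyᴺ-* : ∀ {f g} → Polyᴺ f → Polyᴺ g → Polyᴺ (λ q → f q * g q)
Polyᴺ-* {f} {g} p p′ = Poly-cong (ev-all λ q → ℤP.pos-* (f q) (g q)) (Poly-* p p′)

-- Read off from the eventual sign of `g - f`. It settles truncated subtraction, the order test in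
-- `quoᴺ` and the recognition of powers of two.
ev-≤⊎> : ∀ {f g} → Polyᴺ f → Polyᴺ g →
         Eventually (λ q → f q ≤ g q) ⊎ Eventually (λ q → g q < f q)
ev-≤⊎> p p′ with eventualSign (Poly-minus p′ p)
... | zero d≡0     = inj₁ (ev-map (λ eq → ℤP.drop‿+≤+ (ℤP.0≤i-j⇒j≤i (ℤP.≤-reflexive (sym eq)))) d≡0)
... | positive 0<d = inj₁ (ev-map (λ lt → ℤP.drop‿+≤+ (ℤP.0≤i-j⇒j≤i (ℤP.<⇒≤ lt))) 0<d)
... | negative d<0 = inj₂ (ev-map (λ lt → ≰⇒> λ le → ℤP.<⇒≱ lt (ℤP.i≤j⇒0≤j-i (ℤ.+≤+ le))) d<0)

Polyᴺ-∸ : ∀ {f g} → Polyᴺ f → Polyᴺ g → Polyᴺ (λ q → f q ∸ g q)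
Polyᴺ-∸ {f} {g} p p′ with ev-≤⊎> p p′
... | inj₁ f≤g = Polyᴺ-zero (ev-map m≤n⇒m∸n≡0 f≤g)
... | inj₂ g<f = Poly-cong (ev-map (λ {q} lt → sym (trans (ℤP.m-n≡m⊖n (f q) (g q)) (ℤP.⊖-≥ (<⇒≤ lt)))) g<f)
                           (Poly-minus p p′)

Polyᴺ-po : ∀ {f} → Polyᴺ f → Polyᴺ (λ q → poᴺ (f q))
-- `poᴺ` compares powers of two with `x + 1`, so the enclosure is taken for `f + 1`, which is
-- positive at every `q`.
Polyᴺ-po {f} p with dyadicBounds (Polyᴺ-+ p (Poly-const 1ℤ)) (ev-all λ q → ℤ.+<+ (m≤n+m 1 (f q)))
... | bounds {e} A lo hi = Polyᴺ-cong
  (ev-zip (λ {q} lo hi → poᴺ-unique (f q) (e q) (ℤP.drop‿+≤+ lo) (ℤP.drop‿+<+ hi)) lo hi) (Poly-pow A)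

¬IsPow₂-0 : ¬ IsPow₂ 0
¬IsPow₂-0 (n , eq) = <⇒≢ (m^n>0 2 n) eq

between⇒¬IsPow₂ : ∀ {n} e → 2 ^ e < n → n < 2 ^ suc e → ¬ IsPow₂ n
between⇒¬IsPow₂ e lo hi (k , refl) = <⇒≱ (2^-cancel-< e k lo) (≤-pred (2^-cancel-< k (suc e) hi))

data EventualPow₂ (f : ℕ → ℕ) : Set where
  isPow₂  : ∀ {e} → Affine e → Eventually (λ q → f q ≡ 2 ^ e q) → EventualPow₂ f
  notPow₂ : Eventually (λ q → ¬ IsPow₂ (f q)) → EventualPow₂ f

-- Inside the enclosure from `2 ^ e` to `2 ^ suc e`, the only power of two is the left end, so
-- comparing `f` with `2 ^ e` decides.
eventualPow₂ : ∀ {f} → Polyᴺ f → EventualPow₂ f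
eventualPow₂ {f} p with eventualSign p
... | negative f<0 = ⊥-elim (ev-const (ev-map 0≤+n f<0))
... | zero f≡0 = notPow₂ (ev-map (λ eq → subst (λ n → ¬ IsPow₂ n) (sym (ℤP.+-injective eq)) ¬IsPow₂-0) f≡0)
... | positive 0<f with dyadicBounds p 0<f
...   | bounds {e} A lo hi with ev-≤⊎> p (Poly-pow A)
...     | inj₁ f≤ = isPow₂ A (ev-zip (λ le lo → ≤-antisym le (ℤP.drop‿+≤+ lo)) f≤ lo)
...     | inj₂ f> = notPow₂ (ev-zip (λ {q} gt hi → between⇒¬IsPow₂ (e q) gt (ℤP.drop‿+<+ hi)) f> hi)

Polyᴺ-quo : ∀ {f g} → Polyᴺ f → Polyᴺ g → Polyᴺ (λ q → quoᴺ (f q) (g q))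
Polyᴺ-quo {f} {g} p p′ with eventualPow₂ p | eventualPow₂ p′ | ev-≤⊎> p p′
... | notPow₂ ¬f | _ | _ = Polyᴺ-zero (ev-map (λ {q} ¬f → quoᴺ-zero (f q) (g q) λ (pf , _) → ¬f pf) ¬f)
... | isPow₂ _ _ | notPow₂ ¬g | _ = Polyᴺ-zero (ev-map (λ {q} ¬g → quoᴺ-zero (f q) (g q) λ (_ , pg , _) → ¬g pg) ¬g)
... | isPow₂ _ _ | isPow₂ _ _ | inj₂ g<f =
  Polyᴺ-zero (ev-map (λ {q} lt → quoᴺ-zero (f q) (g q) λ (_ , _ , le) → <⇒≱ lt le) g<f)
... | isPow₂ {a} A f≡ | isPow₂ {b} B g≡ | inj₁ f≤g = Polyᴺ-cong
  (ev-zip₃ (λ {q} eq eq′ le → quoᴺ-pow (f q) (g q) (a q) (b q) eq eq′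
    (2^-cancel-≤ (a q) (b q) (subst (_≤ 2 ^ b q) eq (subst (f q ≤_) eq′ le)))) f≡ g≡ f≤g)
  (Poly-pow (Affine-∸ B A))

record OddPartᴺ (f : ℕ → ℕ) : Set where
  constructor oddPartᴺ
  field
    {exponent} : ℕ → ℕ
    {half-odd} : ℕ → ℕ
    affine     : Affine exponent
    poly       : Polyᴺ half-odd
    factors    : Eventually (λ q → f q ≡ 2 ^ exponent q * (1 + 2 * half-odd q))

zero-or-oddPartᴺ : ∀ {f} → Polyᴺ f → Eventually (λ q → f q ≡ 0) ⊎ OddPartᴺ f
zero-or-oddPartᴺ p with zero-or-oddPart p
... | inj₁ f≡0 = inj₁ (ev-map ℤP.+-injective f≡0)
... | inj₂ (oddPart {e} {h} A p′ f≡) with ev-map (λ {q} → +[2^e*odd] (e q) (h q)) f≡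
...   | f≡′ = inj₂ (oddPartᴺ A (Poly-cong (ev-map proj₁ f≡′) p′) (ev-map proj₂ f≡′))

Polyᴺ-odd : ∀ {f} → Polyᴺ f → Polyᴺ (λ q → 1 + 2 * f q)
Polyᴺ-odd p = Polyᴺ-+ (Poly-const 1ℤ) (Polyᴺ-* (Poly-const (+ 2)) p)

Polyᴺ-half : ∀ {f} → Polyᴺ f → Polyᴺ (λ q → halfᴺ (f q))
Polyᴺ-half p with zero-or-oddPartᴺ p
... | inj₁ f≡0 = Polyᴺ-zero (ev-map (cong halfᴺ) f≡0)
... | inj₂ (oddPartᴺ {e} {k} A p′ f≡) with Affine-zero? A
-- Exponent 0 means that `f` is eventually odd, where `halfᴺ` takes its default value 0.
...   | inj₁ e≡0 = Polyᴺ-zero (ev-zip (λ {q} eq e≡0 → trans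
        (cong halfᴺ (trans eq (trans (cong (λ e → 2 ^ e * (1 + 2 * k q)) e≡0) (*-identityˡ (1 + 2 * k q)))))
        (halfᴺ-odd (k q))) f≡ e≡0)
...   | inj₂ e≡suc = Polyᴺ-cong (ev-zip (λ {q} eq e≡suc → trans
        (cong halfᴺ (trans eq (trans (cong (λ e → 2 ^ e * (1 + 2 * k q)) e≡suc) (*-assoc 2 (2 ^ (e q ∸ 1)) _))))
        (halfᴺ-even (2 ^ (e q ∸ 1) * (1 + 2 * k q)))) f≡ e≡suc)
        (Polyᴺ-* (Poly-pow (Affine-pred A)) (Polyᴺ-odd p′))

Polyᴺ-obst : ∀ {f} → Polyᴺ f → Polyᴺ (λ q → obstᴺ (f q))
Polyᴺ-obst p with zero-or-oddPartᴺ p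
-- The value 3 is the convention for `obst` at 0.
... | inj₁ f≡0 = Polyᴺ-cong (ev-map (cong obstᴺ) f≡0) (Poly-const (+ 3))
... | inj₂ (oddPartᴺ {e} {k} A p′ f≡) = Polyᴺ-cong
  (ev-map (λ {q} eq → trans (cong obstᴺ eq) (obstᴺ-2^*odd (e q) (k q))) f≡) (Polyᴺ-odd p′)

Polyᴺ-cof : ∀ {f} → Polyᴺ f → Polyᴺ (λ q → cofᴺ (f q))
Polyᴺ-cof p with zero-or-oddPartᴺ p
... | inj₁ f≡0 = Polyᴺ-zero (ev-map (cong cofᴺ) f≡0)
... | inj₂ (oddPartᴺ {e} {k} A p′ f≡) = Polyᴺ-cong
  (ev-map (λ {q} eq → trans (cong cofᴺ eq) (cofᴺ-2^*odd (e q) (k q))) f≡) (Poly-pow A)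

-- The offset 2 of the Horner step encodes the denominator 4 of the coefficient 5/4.
Polyᴺ-c : Polyᴺ c
Polyᴺ-c = Polyᴺ-* (Poly-const (+ 5))
  (Poly-cong (ev-all λ q → sym (ℤP.*-identityʳ (pow (q ∸ 2)))) (Poly-shift 2 (Poly-const 1ℤ)))

Polyᴺ-term : (t : Term 1) → Polyᴺ (λ q → ⟦ t ⟧ (c q ∷ []))
Polyᴺ-term (var zero) = Polyᴺ-c
Polyᴺ-term 0ᵗ         = Poly-const 0ℤ
Polyᴺ-term 1ᵗ         = Poly-const 1ℤ
Polyᴺ-term (s +ᵗ t)   = Polyᴺ-+ (Polyᴺ-term s) (Polyᴺ-term t)
Polyᴺ-term (s *ᵗ t)   = Polyᴺ-* (Polyᴺ-term s) (Polyᴺ-term t)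
Polyᴺ-term (sub s t)  = Polyᴺ-∸ (Polyᴺ-term s) (Polyᴺ-term t)
Polyᴺ-term (quo s t)  = Polyᴺ-quo (Polyᴺ-term s) (Polyᴺ-term t)
Polyᴺ-term (po t)     = Polyᴺ-po (Polyᴺ-term t)
Polyᴺ-term (half t)   = Polyᴺ-half (Polyᴺ-term t)
Polyᴺ-term (obst t)   = Polyᴺ-obst (Polyᴺ-term t)
Polyᴺ-term (cof t)    = Polyᴺ-cof (Polyᴺ-term t)

-- From integer Horner forms to dyadic polynomials

fromℤ : ℤ → ℚ
fromℤ a = a ℚ./ 1

-- `ℚ._/_` reduces fractions by a gcd, so identities between quotients are checked on unnormalised
-- fractions and carried over along `ℚ.fromℚᵘ`.
fromℚᵘ-+ : ∀ x y → ℚ.fromℚᵘ (x ℚᵘ.+ y) ≡ ℚ.fromℚᵘ x ℚ.+ ℚ.fromℚᵘ y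
fromℚᵘ-+ x y = ℚP.toℚᵘ-injective (ℚᵘP.≃-trans (ℚP.toℚᵘ-fromℚᵘ (x ℚᵘ.+ y)) (ℚᵘP.≃-sym
  (ℚᵘP.≃-trans (ℚP.toℚᵘ-homo-+ (ℚ.fromℚᵘ x) (ℚ.fromℚᵘ y))
    (ℚᵘP.+-cong (ℚP.toℚᵘ-fromℚᵘ x) (ℚP.toℚᵘ-fromℚᵘ y)))))

fromℚᵘ-* : ∀ x y → ℚ.fromℚᵘ (x ℚᵘ.* y) ≡ ℚ.fromℚᵘ x ℚ.* ℚ.fromℚᵘ y
fromℚᵘ-* x y = ℚP.toℚᵘ-injective (ℚᵘP.≃-trans (ℚP.toℚᵘ-fromℚᵘ (x ℚᵘ.* y)) (ℚᵘP.≃-sym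
  (ℚᵘP.≃-trans (ℚP.toℚᵘ-homo-* (ℚ.fromℚᵘ x) (ℚ.fromℚᵘ y))
    (ℚᵘP.*-cong (ℚP.toℚᵘ-fromℚᵘ x) (ℚP.toℚᵘ-fromℚᵘ y)))))

fromℤ-+ : ∀ a b → fromℤ (a ℤ.+ b) ≡ fromℤ a ℚ.+ fromℤ b
fromℤ-+ a b = trans
  (ℚP.fromℚᵘ-cong {ℚᵘ.mkℚᵘ (a ℤ.+ b) 0} {ℚᵘ.mkℚᵘ a 0 ℚᵘ.+ ℚᵘ.mkℚᵘ b 0} (ℚᵘ.*≡* (lemma a b)))
  (fromℚᵘ-+ (ℚᵘ.mkℚᵘ a 0) (ℚᵘ.mkℚᵘ b 0))
  where
  lemma : ∀ a b → (a ℤ.+ b) ℤ.* 1ℤ ≡ (a ℤ.* 1ℤ ℤ.+ b ℤ.* 1ℤ) ℤ.* 1ℤ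
  lemma = ℤSolver.solve-∀

fromℤ-* : ∀ a b → fromℤ (a ℤ.* b) ≡ fromℤ a ℚ.* fromℤ b
fromℤ-* a b = fromℚᵘ-* (ℚᵘ.mkℚᵘ a 0) (ℚᵘ.mkℚᵘ b 0)

a/n*n≡a : ∀ a n .{{_ : NonZero n}} → (a ℚ./ n) ℚ.* fromℕ n ≡ fromℤ a
a/n*n≡a a n@(suc n-1) = trans (sym (fromℚᵘ-* (ℚᵘ.mkℚᵘ a n-1) (ℚᵘ.mkℚᵘ (+ n) 0)))
  (ℚP.fromℚᵘ-cong {ℚᵘ.mkℚᵘ a n-1 ℚᵘ.* ℚᵘ.mkℚᵘ (+ n) 0} {ℚᵘ.mkℚᵘ a 0} (ℚᵘ.*≡* (trans (ℤP.*-identityʳ (a ℤ.* + n))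
    (cong (λ k → a ℤ.* + k) (sym (*-identityʳ n))))))

fromℕ-pow-+ : ∀ m n → fromℕ (2 ^ (m + n)) ≡ fromℕ (2 ^ m) ℚ.* fromℕ (2 ^ n)
fromℕ-pow-+ m n = trans (cong fromℤ (pow-+ m n)) (fromℤ-* (pow m) (pow n))

-- The factor 2 ^ k accumulates the denominators 2 ^ m of the enclosing Horner steps.
Poly⇒𝔻[T] : ∀ {f} → Poly f → ∀ k →
  Σ[ Q ∈ 𝔻[T] ] Eventually (λ q → fromℤ (f q) ≡ eval Q (fromℕ (U q)) ℚ.* fromℕ (2 ^ k))
Poly⇒𝔻[T] (null f≡0) k = [] , ev-map (λ eq → trans (cong fromℤ eq) (sym (ℚP.*-zeroˡ (fromℕ (2 ^ k))))) f≡0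
Poly⇒𝔻[T] {f} (horner m a {g} p f≡) k with Poly⇒𝔻[T] p (m + k)
... | Q , g≡ = mk𝔻 ((a ℚ./ 2 ^ k) {{m^n≢0 2 k}}) (a , k , refl) ∷ Q ,
  ev-zip₃ (λ {q} eq eq′ le →
    let E = eval Q (fromℕ (U q)); A = (a ℚ./ 2 ^ k) {{m^n≢0 2 k}}
        R = fromℕ (2 ^ (q ∸ m)); M = fromℕ (2 ^ m); K = fromℕ (2 ^ k) in begin
    fromℤ (f q)                                          ≡⟨ cong fromℤ eq ⟩
    fromℤ (a ℤ.+ pow (q ∸ m) ℤ.* g q)                    ≡⟨ fromℤ-+ a (pow (q ∸ m) ℤ.* g q) ⟩
    fromℤ a ℚ.+ fromℤ (pow (q ∸ m) ℤ.* g q)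
      ≡⟨ cong₂ ℚ._+_ (sym (a/n*n≡a a (2 ^ k) {{m^n≢0 2 k}})) (fromℤ-* (pow (q ∸ m)) (g q)) ⟩
    A ℚ.* K ℚ.+ R ℚ.* fromℤ (g q)
      ≡⟨ cong (λ x → A ℚ.* K ℚ.+ R ℚ.* x) (trans eq′ (cong (E ℚ.*_) (fromℕ-pow-+ m k))) ⟩
    A ℚ.* K ℚ.+ R ℚ.* (E ℚ.* (M ℚ.* K))                  ≡⟨ lemma A K R E M ⟩
    (A ℚ.+ (R ℚ.* M) ℚ.* E) ℚ.* K
      ≡⟨ cong (λ u → (A ℚ.+ u ℚ.* E) ℚ.* K)
           (trans (sym (fromℕ-pow-+ (q ∸ m) m)) (cong (λ n → fromℕ (2 ^ n)) (m∸n+n≡m le))) ⟩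
    (A ℚ.+ fromℕ (U q) ℚ.* E) ℚ.* K                      ∎) f≡ g≡ (ev-≥ m)
  where
  open ≡-Reasoning
  open +-*-Solver
  lemma : ∀ A K R E M → A ℚ.* K ℚ.+ R ℚ.* (E ℚ.* (M ℚ.* K)) ≡ (A ℚ.+ (R ℚ.* M) ℚ.* E) ℚ.* K
  lemma = solve 5 (λ A K R E M → A :* K :+ R :* (E :* (M :* K)) := (A :+ (R :* M) :* E) :* K) refl

lemma8 : (t : Term 1) → Σ[ Q ∈ 𝔻[T] ] Σ[ qₜ ∈ ℕ ] ((q : ℕ) → 2 ≤ q → qₜ ≤ q → fromℕ (⟦ t ⟧ (c q ∷ [])) ≡ eval Q (fromℕ (U q)))
-- No denominator has accumulated at the outermost Horner step, so `k` starts at 0 and the factor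
-- `2 ^ 0` is 1.
lemma8 t with Poly⇒𝔻[T] (Polyᴺ-term t) 0
... | Q , eventually N h = Q , N , λ q _ le → trans (h q le) (ℚP.*-identityʳ _)
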